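{- Let $n\ge 8$ be an integer and define $h(n)=2n$ if $n\equiv 0 \pmod 4$ and $h(n)=2n+1$ otherwise. Then the minimum number of edges of a $4$-connected locally nonforesty graph of order $n$ is $h(n)$; that is, every $4$-connected locally nonforesty graph of order $n$ has at least $h(n)$ edges, and there exists a $4$-connected locally nonforesty graph of order $n$ with exactly $h(n)$ edges.
   Context: All graphs are finite and simple. The order of a graph is its number of vertices and its size is its number of edges. For a vertex $v$ of a graph $G$, the local subgraph at $v$ is the subgraph of $G$ induced by the (open) neighborhood $N(v)$ of $v$. A graph $G$ is called locally nonforesty if every local subgraph of $G$ contains a cycle (equivalently, every vertex of $G$ is the hub of a wheel in $G$). -}

module Defs where

open import Data.Nat using (ℕ; zero; suc; _+_; _*_; _≤_; _<_; _≤?_)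
open import Data.Nat.DivMod using (_%_)
open import Data.Nat.Properties renaming (_≟_ to _≟ℕ_) using ()
open import Data.Bool using (Bool; true; false; _∧_; if_then_else_)
open import Data.Fin using (Fin; toℕ)
open import Relation.Nullary using (yes; no)
open import Data.List using (List; []; _∷_; length; filterᵇ; allFin; cartesianProduct; _++_; [_])
open import Data.List.Membership.Propositional using (_∈_; _∉_)
open import Data.List.Relation.Unary.All using (All)
open import Data.List.Relation.Unary.Unique.Propositional using (Unique)
open import Data.List.Relation.Unary.Linked using (Linked)
open import Data.Product using (Σ; _×_; _,_; proj₁; proj₂)
open import Relation.Binary.PropositionalEquality using (_≡_)
open import Relation.Nullary.Decidable using (⌊_⌋)

record Graph (n : ℕ) : Set where
  field
    adj   : Fin n → Fin n → Bool
    irrefl : ∀ v → adj v v ≡ false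
    sym    : ∀ u v → adj u v ≡ adj v u
open Graph public

_~[_]_ : ∀ {n} → Fin n → Graph n → Fin n → Set
u ~[ G ] v = adj G u v ≡ true

size : ∀ {n} → Graph n → ℕ
size {n} G = length (filterᵇ (λ p → ⌊ suc (toℕ (proj₁ p)) ≤? toℕ (proj₂ p) ⌋ ∧ adj G (proj₁ p) (proj₂ p))
                             (cartesianProduct (allFin n) (allFin n)))

data WalkAvoiding {n : ℕ} (G : Graph n) (X : List (Fin n)) : Fin n → Fin n → Set where
  here : ∀ {u} → u ∉ X → WalkAvoiding G X u u
  step : ∀ {u w v} → u ∉ X → u ~[ G ] w → WalkAvoiding G X w v → WalkAvoiding G X u v

ConnectedAvoiding : ∀ {n} → Graph n → List (Fin n) → Set
ConnectedAvoiding {n} G X = ∀ (u v : Fin n) → u ∉ X → v ∉ X → WalkAvoiding G X u v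

KConnected : ∀ {n} → ℕ → Graph n → Set
KConnected {n} k G = (k < n) × (∀ (X : List (Fin n)) → length X < k → ConnectedAvoiding G X)

record CycleIn {n : ℕ} (G : Graph n) (S : Fin n → Set) : Set where
  field
    x      : Fin n
    xs     : List (Fin n)
    long   : 3 ≤ length (x ∷ xs)
    distinct : Unique (x ∷ xs)
    inside : All S (x ∷ xs)
    closed : Linked (λ a b → a ~[ G ] b) ((x ∷ xs) ++ [ x ])

LocallyNonforesty : ∀ {n} → Graph n → Set
LocallyNonforesty {n} G = ∀ (v : Fin n) → CycleIn G (λ w → v ~[ G ] w)

h : ℕ → ℕ
h n with n % 4 ≟ℕ 0
... | yes _ = 2 * n
... | no _  = 2 * n + 1

{-# OPTIONS --safe #-}

-- Lower bound: 4-connectivity forces minimum degree 4, hence at least 2n edges. With exactly 2n the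
-- graph is 4-regular; then a neighbourhood that contains a 4-cycle but no triangle, and likewise two
-- distinct K₄s that meet, would yield a separator of at most three vertices. So every vertex lies in
-- exactly one K₄, the K₄s partition the vertices, and 4 divides n.
-- Upper bound: in a graph where every vertex lies in a K₄ avoiding two given disjoint edges, subdivide
-- each of these edges twice and make the four new vertices a K₄. This preserves 4-connectivity and adds
-- 4 vertices and 8 edges; four small graphs start the induction.
module Submission where

open import Defs
open import Data.Bool using (Bool; true; false; _∧_; not; if_then_else_)
open import Data.Bool.ListAction using (any; or)
open import Data.Bool.Properties using (T-≡; ∧-comm; ∧-identityʳ; ∧-conicalˡ) renaming (_≟_ to _≟ᵇ_)
open import Data.Empty using (⊥; ⊥-elim)
open import Data.Fin using (Fin; zero; suc; toℕ; _≟_; _↑ˡ_; _↑ʳ_; splitAt; #_)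
open import Data.Fin.Patterns using (0F; 1F; 2F; 3F)
open import Data.Fin.Properties using (all?; any?; ¬∀⟶∃¬; toℕ-injective; splitAt-↑ˡ; ↑ˡ-injective; ↑ʳ-injective)
open import Data.List using (List; []; _∷_; length; map; filter; filterᵇ; tabulate; allFin; cartesianProduct; _++_; [_])
open import Data.List.Properties using (length-map; length-++; length-tabulate; filter-++; filter-notAll; map-tabulate; map-cong)
open import Data.List.Membership.Propositional using (_∈_; _∉_; find)
open import Data.List.Membership.Propositional.Properties
  using (∈-map⁺; ∈-map⁻; ∈-filter⁺; ∈-filter⁻; ∈-allFin; ∈-tabulate⁻; ∈-++⁺ˡ; ∈-++⁺ʳ)
open import Data.List.Relation.Binary.Subset.Propositional using (_⊆_)
open import Data.List.Relation.Unary.All as All using (All; []; _∷_)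
open import Data.List.Relation.Unary.AllPairs as AllPairs using (AllPairs; []; _∷_)
open import Data.List.Relation.Unary.Any as Any using (Any; here; there)
open import Data.List.Relation.Unary.Linked using ([-]; _∷_)
open import Data.List.Relation.Unary.Unique.Propositional using (Unique)
import Data.List.Relation.Unary.Unique.Propositional.Properties as Unique
open import Data.Nat using (ℕ; zero; suc; _+_; _*_; _∸_; _≡ᵇ_; _≤_; _<_; z≤n; s≤s; s≤s⁻¹; _≤?_)
open import Data.Nat.DivMod using (_%_)
open import Data.Nat.Divisibility using (_∣_; _∣0; ∣m∣n⇒∣m+n; ∣-refl; n∣m⇒m%n≡0)
open import Data.Nat.Properties renaming (_≟_ to _≟ℕ_)
open import Data.Vec using ([]; _∷_; lookup)
open import Data.Product using (Σ; ∃; _×_; _,_; proj₁; proj₂)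
open import Data.Sum using (_⊎_; inj₁; inj₂; [_,_]′)
open import Function using (_∘_; id; Equivalence; mk⇔)
open import Relation.Binary.PropositionalEquality as ≡ using (_≡_; _≢_; ≢-sym; refl; trans; cong; cong₂; subst)
open import Relation.Nullary using (¬_; Dec; yes; no; contradiction; ¬?)
open import Relation.Nullary.Decidable using (True; ⌊_⌋; does; does-⇔; dec-true; dec-false; toWitness; map′; _×-dec_; _⊎-dec_; _→-dec_)
open import Algebra.Properties.CommutativeMonoid.Sum +-0-commutativeMonoid
  using (sum; sum-cong-≗; ∑-distrib-+; ∑-comm)
import Data.List.Membership.DecPropositional as DecMembership

private
  open module Mem {n} = DecMembership (_≟_ {n}) using (_∈?_)

-- Duplicate-free lists as finite vertex sets

module _ {n : ℕ} where

  infixl 6 _∩_ _∖_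

  _∩_ _∖_ : List (Fin n) → List (Fin n) → List (Fin n)
  L ∩ B = filter (_∈? B) L
  L ∖ B = filter (λ y → ¬? (y ∈? B)) L

  ∈-∩⁺ : ∀ {L B x} → x ∈ L → x ∈ B → x ∈ L ∩ B
  ∈-∩⁺ {B = B} = ∈-filter⁺ (_∈? B)

  ∈-∩⁻ : ∀ L B {x} → x ∈ L ∩ B → x ∈ L × x ∈ B
  ∈-∩⁻ L B = ∈-filter⁻ (_∈? B)

  ∈-∖⁺ : ∀ {L B x} → x ∈ L → x ∉ B → x ∈ L ∖ B
  ∈-∖⁺ {B = B} = ∈-filter⁺ (λ y → ¬? (y ∈? B))

  ∈-∖⁻ : ∀ L B {x} → x ∈ L ∖ B → x ∈ L × x ∉ B
  ∈-∖⁻ L B = ∈-filter⁻ (λ y → ¬? (y ∈? B))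

  length-∖ : ∀ {x} L B → x ∈ L → x ∈ B → length (L ∖ B) < length L
  length-∖ L B x∈L x∈B =
    filter-notAll (λ y → ¬? (y ∈? B)) L (Any.map (λ { refl x∉B → x∉B x∈B }) x∈L)

  length-∩+∖ : ∀ L B → length (L ∩ B) + length (L ∖ B) ≡ length L
  length-∩+∖ []      B = refl
  length-∩+∖ (x ∷ L) B with x ∈? B
  ... | yes _ = cong suc (length-∩+∖ L B)
  ... | no  _ = trans (+-suc _ _) (cong suc (length-∩+∖ L B))

  ∩-unique : ∀ {L} B → Unique L → Unique (L ∩ B)
  ∩-unique B = Unique.filter⁺ (_∈? B)

  ∖-unique : ∀ {L} B → Unique L → Unique (L ∖ B)
  ∖-unique B = Unique.filter⁺ (λ y → ¬? (y ∈? B))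

  ∉-∷⁻ : ∀ {x y : Fin n} {L} → x ∉ y ∷ L → x ≢ y × x ∉ L
  ∉-∷⁻ x∉ = (λ x≡y → x∉ (here x≡y)) , (λ x∈ → x∉ (there x∈))

  ∉-∷⁺ : ∀ {x y : Fin n} {L} → x ≢ y → x ∉ L → x ∉ y ∷ L
  ∉-∷⁺ x≢y _   (here x≡y)  = x≢y x≡y
  ∉-∷⁺ _   x∉L (there x∈L) = x∉L x∈L

  ∉-[] : ∀ {x : Fin n} → x ∉ []
  ∉-[] ()

  -- Pigeonhole by induction: deleting the head of `xs` from `ys` shortens `ys`, and by distinctness
  -- the tail of `xs` still embeds.
  unique-⊆-length : ∀ {xs ys : List (Fin n)} → Unique xs → xs ⊆ ys → length xs ≤ length ys
  unique-⊆-length []        _  = z≤n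
  unique-⊆-length (x≢ ∷ u) sub = ≤-trans
    (s≤s (unique-⊆-length u λ y∈ → ∈-∖⁺ (sub (there y∈)) (∉-∷⁺ (≢-sym (All.lookup x≢ y∈)) ∉-[])))
    (length-∖ _ [ _ ] (sub (here refl)) (here refl))

  unique-∷ : ∀ {x : Fin n} {L} → x ∉ L → Unique L → Unique (x ∷ L)
  unique-∷ x∉L u = All.tabulate (λ y∈ x≡y → x∉L (subst (_∈ _) (≡.sym x≡y) y∈)) ∷ u

  fresh : (L : List (Fin n)) → length L < n → ∃ λ u → u ∉ L
  fresh L short = ¬∀⟶∃¬ n (_∈ L) (_∈? L) λ all → <⇒≱ short (begin
    n                 ≡⟨ length-tabulate id ⟨
    length (allFin n) ≤⟨ unique-⊆-length (Unique.allFin⁺ n) (λ {u} _ → all u) ⟩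
    length L          ∎)
    where open ≤-Reasoning

-- Adjacency and walks avoiding a vertex set

module _ {n : ℕ} (G : Graph n) where

  ~-sym : ∀ {u v} → u ~[ G ] v → v ~[ G ] u
  ~-sym {u} {v} u~v = trans (sym G v u) u~v

  ~⇒≢ : ∀ {u v} → u ~[ G ] v → u ≢ v
  ~⇒≢ {u} u~u refl with () ← trans (≡.sym u~u) (irrefl G u)

  ~?  : ∀ u v → Dec (u ~[ G ] v)
  ~? u v with adj G u v
  ... | true  = yes refl
  ... | false = no λ ()

module _ {n : ℕ} {G : Graph n} {X : List (Fin n)} where

  start∉ : ∀ {u v} → WalkAvoiding G X u v → u ∉ X
  start∉ (here u∉)     = u∉
  start∉ (step u∉ _ _) = u∉

  walk-trans : ∀ {u v w} → WalkAvoiding G X u v → WalkAvoiding G X v w → WalkAvoiding G X u w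
  walk-trans (here _)       q = q
  walk-trans (step u∉ e p) q = step u∉ e (walk-trans p q)

  walk-edge : ∀ {u v} → u ∉ X → v ∉ X → u ~[ G ] v → WalkAvoiding G X u v
  walk-edge u∉ v∉ e = step u∉ e (here v∉)

  walk-sym : ∀ {u v} → WalkAvoiding G X u v → WalkAvoiding G X v u
  walk-sym (here u∉)      = here u∉
  walk-sym (step u∉ e p) = walk-trans (walk-sym p) (walk-edge (start∉ p) u∉ (~-sym G e))

  -- The cut argument: applied to a set `P` whose outside neighbours all lie in `X`, it will
  -- contradict connectivity after deletion of `X`.
  walk-invariant : (P : Fin n → Set) → (∀ {u w} → P u → u ~[ G ] w → P w ⊎ w ∈ X) →
    ∀ {u v} → P u → WalkAvoiding G X u v → P v
  walk-invariant P closed Pu (here _)      = Pu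
  walk-invariant P closed Pu (step _ e p) with closed Pu e
  ... | inj₁ Pw  = walk-invariant P closed Pw p
  ... | inj₂ w∈X = contradiction w∈X (start∉ p)

-- Since `n` exceeds 4, some vertex lies outside `v ∷ L`; the first step of an `L`-avoiding walk
-- from `v` to it is the neighbour sought.
neighbour-outside : ∀ {n} {G : Graph n} → KConnected 4 G → ∀ v L → length L < 4 → v ∉ L →
  ∃ λ w → v ~[ G ] w × w ∉ L
neighbour-outside (4<n , conn) v L short v∉L with fresh (v ∷ L) (≤-trans (s≤s short) 4<n)
... | u , u∉ with conn L short v u v∉L (u∉ ∘ there)
... | here _      = contradiction (here refl) u∉
... | step _ e p = _ , e , start∉ p

-- Counting

⟦_⟧ : Bool → ℕ
⟦ b ⟧ = if b then 1 else 0

length-filter-tabulate : ∀ {A : Set} (p : A → Bool) {n} (f : Fin n → A) →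
  length (filterᵇ p (tabulate f)) ≡ sum (λ i → ⟦ p (f i) ⟧)
length-filter-tabulate p {zero}  f = refl
length-filter-tabulate p {suc n} f with p (f zero)
... | true  = cong suc (length-filter-tabulate p (f ∘ suc))
... | false = length-filter-tabulate p (f ∘ suc)

length-filter-product : ∀ {A B : Set} (p : A × B → Bool) {m n} (f : Fin m → A) (g : Fin n → B) →
  length (filterᵇ p (cartesianProduct (tabulate f) (tabulate g))) ≡ sum (λ i → sum (λ j → ⟦ p (f i , g j) ⟧))
length-filter-product p {zero}  f g = refl
length-filter-product p {suc m} f g = begin
  length (filterᵇ p (row ++ rest))               ≡⟨ cong length (filter-++ _ row rest) ⟩
  length (filterᵇ p row ++ filterᵇ p rest)       ≡⟨ length-++ (filterᵇ p row) ⟩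
  length (filterᵇ p row) + length (filterᵇ p rest)
    ≡⟨ cong₂ _+_ (trans (cong (length ∘ filterᵇ p) (map-tabulate g (f zero ,_)))
                        (length-filter-tabulate p (λ j → f zero , g j)))
                 (length-filter-product p (f ∘ suc) g) ⟩
  _ ∎
  where
  open ≡.≡-Reasoning
  row  = map (f zero ,_) (tabulate g)
  rest = cartesianProduct (tabulate (f ∘ suc)) (tabulate g)

module _ {n : ℕ} (G : Graph n) where

  deg : Fin n → ℕ
  deg v = sum (λ w → ⟦ adj G v w ⟧)

  nbrs : Fin n → List (Fin n)
  nbrs v = filterᵇ (adj G v) (allFin n)

  length-nbrs : ∀ v → length (nbrs v) ≡ deg v
  length-nbrs v = length-filter-tabulate (adj G v) id

  ∈-nbrs⁺ : ∀ {v w} → v ~[ G ] w → w ∈ nbrs v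
  ∈-nbrs⁺ v~w = ∈-filter⁺ _ (∈-allFin _) (Equivalence.from T-≡ v~w)

  ∈-nbrs⁻ : ∀ {v w} → w ∈ nbrs v → v ~[ G ] w
  ∈-nbrs⁻ w∈ = Equivalence.to T-≡ (proj₂ (∈-filter⁻ _ {xs = allFin n} w∈))

  private
    forwardᵇ : Fin n × Fin n → Bool
    forwardᵇ (u , v) = ⌊ suc (toℕ u) ≤? toℕ v ⌋ ∧ adj G u v

    forward : Fin n → Fin n → ℕ
    forward u v = ⟦ forwardᵇ (u , v) ⟧

    -- `size` counts an edge only from its smaller end, so exactly one of its two orientations is
    -- forward; on the diagonal both sides vanish.
    forward-sym : ∀ u v → forward u v + forward v u ≡ ⟦ adj G u v ⟧
    forward-sym u v with suc (toℕ u) ≤? toℕ v | suc (toℕ v) ≤? toℕ u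
    ... | yes u<v | yes v<u = contradiction v<u (<⇒≯ u<v)
    ... | yes _   | no _    = +-identityʳ _
    ... | no _    | yes _   = cong ⟦_⟧ (sym G v u)
    ... | no u≮v  | no v≮u
      rewrite toℕ-injective (≤-antisym (≮⇒≥ v≮u) (≮⇒≥ u≮v)) | irrefl G v = refl

  handshake : sum deg ≡ size G + size G
  handshake = begin
    sum (λ u → sum (λ v → ⟦ adj G u v ⟧))
      ≡⟨ sum-cong-≗ (λ u → sum-cong-≗ (λ v → ≡.sym (forward-sym u v))) ⟩
    sum (λ u → sum (λ v → forward u v + forward v u))
      ≡⟨ sum-cong-≗ (λ u → ∑-distrib-+ (forward u) (λ v → forward v u)) ⟩
    sum (λ u → sum (forward u) + sum (λ v → forward v u))
      ≡⟨ ∑-distrib-+ (λ u → sum (forward u)) _ ⟩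
    sum (λ u → sum (forward u)) + sum (λ u → sum (λ v → forward v u))
      ≡⟨ cong₂ _+_ size-sum (trans size-sum (∑-comm forward)) ⟨
    size G + size G ∎
    where
    open ≡.≡-Reasoning
    size-sum : size G ≡ sum (λ u → sum (forward u))
    size-sum = length-filter-product forwardᵇ {n} {n} id id

sum-≥ : ∀ {n k} (f : Fin n → ℕ) → (∀ i → k ≤ f i) → n * k ≤ sum f
sum-≥ {zero}  f k≤ = z≤n
sum-≥ {suc n} f k≤ = +-mono-≤ (k≤ zero) (sum-≥ (f ∘ suc) (k≤ ∘ suc))

-- The other terms already contribute `k` each, leaving at most `k` for term `i`. This turns `2 * n`
-- edges and minimum degree 4 into 4-regularity.
sum-tight : ∀ {n k} (f : Fin n → ℕ) → (∀ i → k ≤ f i) → sum f ≤ n * k → ∀ i → f i ≤ k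
sum-tight {suc n} {k} f k≤ tight zero    =
  +-cancelʳ-≤ (n * k) _ _ (≤-trans (+-monoʳ-≤ (f zero) (sum-≥ (f ∘ suc) (k≤ ∘ suc))) tight)
sum-tight {suc n} {k} f k≤ tight (suc i) =
  sum-tight (f ∘ suc) (k≤ ∘ suc) (+-cancelˡ-≤ k _ _ (≤-trans (+-monoˡ-≤ _ (k≤ zero)) tight)) i

-- Lower bound

-- Distinctness of the four vertices is implied, since adjacency is irreflexive.
K₄ : ∀ {n} → Graph n → List (Fin n) → Set
K₄ G L = AllPairs (λ u v → u ~[ G ] v) L × length L ≡ 4

module _ {n : ℕ} (G : Graph n) where

  clique⇒unique : ∀ {L} → AllPairs (λ u v → u ~[ G ] v) L → Unique L
  clique⇒unique = AllPairs.map (~⇒≢ G)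

  clique-adj : ∀ {L x y} → AllPairs (λ u v → u ~[ G ] v) L → x ∈ L → y ∈ L → x ≢ y → x ~[ G ] y
  clique-adj (x~ ∷ c) (here refl) (here refl) x≢y = contradiction refl x≢y
  clique-adj (x~ ∷ c) (here refl) (there y∈)  _   = All.lookup x~ y∈
  clique-adj (y~ ∷ c) (there x∈)  (here refl) _   = ~-sym G (All.lookup y~ x∈)
  clique-adj (_  ∷ c) (there x∈)  (there y∈)  x≢y = clique-adj c x∈ y∈ x≢y

  -- The only cycles possible inside a neighbourhood of at most four vertices. In a triangle,
  -- adjacency already gives distinctness; in a square, opposite corners need it separately.
  data ShortCycle (S : Fin n → Set) : Set where
    triangle : ∀ {x y z} → S x → S y → S z → x ~[ G ] y → y ~[ G ] z → z ~[ G ] x → ShortCycle S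
    square   : ∀ {x y z w} → Unique (x ∷ y ∷ z ∷ w ∷ []) → S x → S y → S z → S w →
               x ~[ G ] y → y ~[ G ] z → z ~[ G ] w → w ~[ G ] x → ShortCycle S

  shortCycle : ∀ {S} → (∀ {L} → Unique L → All S L → length L ≤ 4) → CycleIn G S → ShortCycle S
  shortCycle few record { x = x ; xs = [] ; long = s≤s () }
  shortCycle few record { x = x ; xs = _ ∷ [] ; long = s≤s (s≤s ()) }
  shortCycle few record { xs = y ∷ z ∷ [] ; inside = a ∷ b ∷ c ∷ [] ; closed = e ∷ f ∷ g ∷ [-] } =
    triangle a b c e f g
  shortCycle few record { xs = y ∷ z ∷ w ∷ [] ; distinct = u ; inside = a ∷ b ∷ c ∷ d ∷ []
                        ; closed = e ∷ f ∷ g ∷ h ∷ [-] } = square u a b c d e f g h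
  shortCycle few record { xs = _ ∷ _ ∷ _ ∷ _ ∷ _ ; distinct = u ; inside = i }
    with s≤s (s≤s (s≤s (s≤s ()))) ← few u i

  -- With fewer than four neighbours, `nbrs G v` could itself be deleted, yet `v` would still need a
  -- neighbour outside it.
  min-degree : KConnected 4 G → ∀ v → 4 ≤ deg G v
  min-degree conn v with 4 ≤? deg G v
  ... | yes 4≤d = 4≤d
  ... | no  4≰d
    with neighbour-outside conn v (nbrs G v)
           (subst (_< 4) (≡.sym (length-nbrs G v)) (≰⇒> 4≰d))
           (λ v∈ → ~⇒≢ G (∈-nbrs⁻ G v∈) refl)
  ... | _ , v~w , w∉ = contradiction (∈-nbrs⁺ G v~w) w∉

  2n≤size : KConnected 4 G → 2 * n ≤ size G
  2n≤size conn = *-cancelˡ-≤ 2 (begin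
    2 * (2 * n)       ≡⟨ trans (≡.sym (*-assoc 2 2 n)) (*-comm 4 n) ⟩
    n * 4             ≤⟨ sum-≥ (deg G) (min-degree conn) ⟩
    sum (deg G)       ≡⟨ handshake G ⟩
    size G + size G   ≡⟨ cong (size G +_) (+-identityʳ _) ⟨
    2 * size G        ∎)
    where open ≤-Reasoning

  2n≡size⇒regular : KConnected 4 G → size G ≡ 2 * n → ∀ v → length (nbrs G v) ≤ 4
  2n≡size⇒regular conn eq v = subst (_≤ 4) (≡.sym (length-nbrs G v))
    (sum-tight (deg G) (min-degree conn) (≤-reflexive (begin
      sum (deg G)       ≡⟨ handshake G ⟩
      size G + size G   ≡⟨ cong (size G +_) (+-identityʳ _) ⟨
      2 * size G        ≡⟨ cong (2 *_) eq ⟩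
      2 * (2 * n)       ≡⟨ trans (≡.sym (*-assoc 2 2 n)) (*-comm 4 n) ⟩
      n * 4             ∎)) v)
    where open ≡.≡-Reasoning

-- Partition of a 4-regular graph into K₄s

module FourRegular {n : ℕ} (G : Graph n) (8≤n : 8 ≤ n) (conn : KConnected 4 G)
  (loc : LocallyNonforesty G) (reg : ∀ v → length (nbrs G v) ≤ 4) where

  private
    _~_ : Fin n → Fin n → Set
    u ~ v = u ~[ G ] v

  few : ∀ {v L} → Unique L → All (v ~_) L → length L ≤ 4
  few {v} u all = ≤-trans (unique-⊆-length u λ x∈ → ∈-nbrs⁺ G (All.lookup all x∈)) (reg v)

  -- Four distinct neighbours of `v` exhaust its neighbourhood: a further one would be a fifth.
  neighbourhood-⊆ : ∀ {v w L} → Unique L → 4 ≤ length L → All (v ~_) L → v ~ w → w ∈ L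
  neighbourhood-⊆ {v} {w} {L} u long all v~w with w ∈? L
  ... | yes w∈ = w∈
  ... | no  w∉ = contradiction (few (unique-∷ w∉ u) (v~w ∷ all)) (<⇒≱ (s≤s long))

  -- `L` bounds the union of `P` and `X`, so some vertex lies beyond both; a walk to it from `s`
  -- avoiding `X` could never leave `P`.
  no-separator : (P : Fin n → Set) (X L : List (Fin n)) → length X < 4 → length L < n →
    (∀ {u w} → P u → u ~ w → P w ⊎ w ∈ X) → (∀ {u} → P u ⊎ u ∈ X → u ∈ L) →
    ∀ {s} → P s → s ∉ X → ⊥
  no-separator P X L short small closed cover {s} Ps s∉ =
    let u , u∉ = fresh L small
    in u∉ (cover (inj₁ (walk-invariant P closed Ps (proj₂ conn X short s u s∉ (u∉ ∘ cover ∘ inj₂)))))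

  -- A neighbourhood with bipartition {v , v'} , {b , d} has no triangle, so its cycle is a 4-cycle.
  bipartite-neighbourhood : ∀ {a v v' b d} → Unique (v ∷ v' ∷ b ∷ d ∷ []) →
    All (a ~_) (v ∷ v' ∷ b ∷ d ∷ []) → ¬ v ~ v' → ¬ b ~ d → v' ~ b × v' ~ d
  bipartite-neighbourhood {a} {v} {v'} {b} {d} u a~@(_ ∷ a~v' ∷ _) v≁v' b≁d =
    go (shortCycle G few (loc a))
    where
    P Q : Fin n → Set
    P x = x ≡ v ⊎ x ≡ v'
    Q x = x ≡ b ⊎ x ≡ d

    side : ∀ {x} → a ~ x → P x ⊎ Q x
    side a~x with neighbourhood-⊆ u ≤-refl a~ a~x
    ... | here e                         = inj₁ (inj₁ e)
    ... | there (here e)                 = inj₁ (inj₂ e)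
    ... | there (there (here e))         = inj₂ (inj₁ e)
    ... | there (there (there (here e))) = inj₂ (inj₂ e)

    PP : ∀ {x y} → P x → P y → ¬ x ~ y
    PP (inj₁ refl) (inj₁ refl) e = ~⇒≢ G e refl
    PP (inj₁ refl) (inj₂ refl) e = v≁v' e
    PP (inj₂ refl) (inj₁ refl) e = v≁v' (~-sym G e)
    PP (inj₂ refl) (inj₂ refl) e = ~⇒≢ G e refl

    QQ : ∀ {x y} → Q x → Q y → ¬ x ~ y
    QQ (inj₁ refl) (inj₁ refl) e = ~⇒≢ G e refl
    QQ (inj₁ refl) (inj₂ refl) e = b≁d e
    QQ (inj₂ refl) (inj₁ refl) e = b≁d (~-sym G e)
    QQ (inj₂ refl) (inj₂ refl) e = ~⇒≢ G e refl

    in-Q : ∀ {x} → a ~ x → v' ~ x → Q x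
    in-Q a~x v'~x with side a~x
    ... | inj₁ p = contradiction v'~x (PP (inj₂ refl) p)
    ... | inj₂ q = q

    both : ∀ {x y} → x ≢ y → a ~ x → a ~ y → v' ~ x → v' ~ y → v' ~ b × v' ~ d
    both x≢y a~x a~y v'~x v'~y with in-Q a~x v'~x | in-Q a~y v'~y
    ... | inj₁ refl | inj₁ refl = contradiction refl x≢y
    ... | inj₁ refl | inj₂ refl = v'~x , v'~y
    ... | inj₂ refl | inj₁ refl = v'~y , v'~x
    ... | inj₂ refl | inj₂ refl = contradiction refl x≢y

    go : ShortCycle G (a ~_) → v' ~ b × v' ~ d
    go (triangle x y z xy yz zx) with side x | side y | side z
    ... | inj₁ p | inj₁ q | _      = contradiction xy (PP p q)
    ... | inj₁ p | inj₂ q | inj₁ r = contradiction zx (PP r p)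
    ... | inj₁ p | inj₂ q | inj₂ r = contradiction yz (QQ q r)
    ... | inj₂ p | inj₂ q | _      = contradiction xy (QQ p q)
    ... | inj₂ p | inj₁ q | inj₁ r = contradiction yz (PP q r)
    ... | inj₂ p | inj₁ q | inj₂ r = contradiction zx (QQ r p)
    -- The square fills the neighbourhood of `a`, so it passes through `v'`; its two neighbours on
    -- the square are distinct and lie on the side of `b` and `d`.
    go (square w@((_ ∷ x≢z ∷ _ ∷ []) ∷ (_ ∷ y≢t ∷ []) ∷ _) x y z t xy yz zt tx)
      with neighbourhood-⊆ w ≤-refl (x ∷ y ∷ z ∷ t ∷ []) a~v'
    ... | here refl                         = both y≢t y t xy (~-sym G tx)
    ... | there (here refl)                 = both x≢z x z (~-sym G xy) yz
    ... | there (there (here refl))         = both y≢t y t (~-sym G yz) zt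
    ... | there (there (there (here refl))) = both x≢z x z tx (~-sym G zt)

  -- A vertex v whose neighbourhood is an induced 4-cycle a b c d gives an octahedron:
  -- a, b, d share a further neighbour a', and {c , a'} separates {v , a , b , d}.
  no-induced-square : ∀ {v a b c d} → Unique (a ∷ b ∷ c ∷ d ∷ []) → All (v ~_) (a ∷ b ∷ c ∷ d ∷ []) →
    a ~ b → b ~ c → c ~ d → d ~ a → ¬ a ~ c → ¬ b ~ d → ⊥
  no-induced-square {v} {a} {b} {c} {d} u@((_ ∷ a≢c ∷ _ ∷ []) ∷ (_ ∷ b≢d ∷ []) ∷ _)
    v~@(va ∷ vb ∷ vc ∷ vd ∷ []) ab bc cd da a≁c b≁d
    -- The fourth neighbour of `a`, besides `v`, `b` and `d`.
    with neighbour-outside conn a (v ∷ b ∷ d ∷ []) ≤-refl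
           (∉-∷⁺ (~⇒≢ G (~-sym G va)) (∉-∷⁺ (~⇒≢ G ab) (∉-∷⁺ (~⇒≢ G (~-sym G da)) ∉-[])))
  ... | a' , aa' , a'∉ = no-separator (_∈ S) X (v ∷ a ∷ b ∷ d ∷ c ∷ a' ∷ []) (s≤s (s≤s (s≤s z≤n)))
      (≤-trans (s≤s (s≤s (s≤s (s≤s (s≤s (s≤s (s≤s z≤n))))))) 8≤n) closed cover {v} (here refl)
      (∉-∷⁺ (~⇒≢ G vc) (∉-∷⁺ (≢-sym a'≢v) ∉-[]))
    where
    S X : List (Fin n)
    S = v ∷ a ∷ b ∷ d ∷ []
    X = c ∷ a' ∷ []

    a'≢v : a' ≢ v
    a'≢v = proj₁ (∉-∷⁻ a'∉)

    a'≢b : a' ≢ b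
    a'≢b = proj₁ (∉-∷⁻ (proj₂ (∉-∷⁻ a'∉)))

    a'≢d : a' ≢ d
    a'≢d = proj₁ (∉-∷⁻ (proj₂ (∉-∷⁻ (proj₂ (∉-∷⁻ a'∉)))))

    a'≢c : a' ≢ c
    a'≢c refl = a≁c aa'

    v≁a' : ¬ v ~ a'
    v≁a' va' with neighbourhood-⊆ u ≤-refl v~ va'
    ... | here refl                         = ~⇒≢ G aa' refl
    ... | there (here e)                    = a'≢b e
    ... | there (there (here e))            = a'≢c e
    ... | there (there (there (here e)))    = a'≢d e

    uₐ : Unique (v ∷ a' ∷ b ∷ d ∷ [])
    uₐ = (≢-sym a'≢v ∷ ~⇒≢ G vb ∷ ~⇒≢ G vd ∷ []) ∷ (a'≢b ∷ a'≢d ∷ []) ∷ (b≢d ∷ []) ∷ [] ∷ []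

    u₃ : Unique (v ∷ a ∷ c ∷ a' ∷ [])
    u₃ = (~⇒≢ G va ∷ ~⇒≢ G vc ∷ ≢-sym a'≢v ∷ []) ∷ (a≢c ∷ ~⇒≢ G aa' ∷ []) ∷ (≢-sym a'≢c ∷ []) ∷ [] ∷ []

    Nₐ : All (a ~_) (v ∷ a' ∷ b ∷ d ∷ [])
    Nₐ = ~-sym G va ∷ aa' ∷ ab ∷ ~-sym G da ∷ []

    -- Local nonforestiness is used a second time, now at `a`, whose neighbourhood has the
    -- nonadjacent pairs `v`, `a'` and `b`, `d`.
    a'~bd : a' ~ b × a' ~ d
    a'~bd = bipartite-neighbourhood uₐ Nₐ v≁a' b≁d

    -- `b` and `d` have the same neighbourhood `v`, `a`, `c`, `a'`.
    around : ∀ {w} → w ∈ v ∷ a ∷ c ∷ a' ∷ [] → w ∈ S ⊎ w ∈ X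
    around (here e)                         = inj₁ (here e)
    around (there (here e))                 = inj₁ (there (here e))
    around (there (there (here e)))         = inj₂ (here e)
    around (there (there (there (here e)))) = inj₂ (there (here e))

    closed : ∀ {x w} → x ∈ S → x ~ w → w ∈ S ⊎ w ∈ X
    closed (here refl) x~w with neighbourhood-⊆ u ≤-refl v~ x~w
    ... | here e                         = inj₁ (there (here e))
    ... | there (here e)                 = inj₁ (there (there (here e)))
    ... | there (there (here e))         = inj₂ (here e)
    ... | there (there (there (here e))) = inj₁ (there (there (there (here e))))
    closed (there (here refl)) x~w with neighbourhood-⊆ uₐ ≤-refl Nₐ x~w
    ... | here e                         = inj₁ (here e)
    ... | there (here e)                 = inj₂ (there (here e))
    ... | there (there (here e))         = inj₁ (there (there (here e)))
    ... | there (there (there (here e))) = inj₁ (there (there (there (here e))))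
    closed (there (there (here refl))) x~w = around (neighbourhood-⊆ u₃ ≤-refl
      (~-sym G vb ∷ ~-sym G ab ∷ bc ∷ ~-sym G (proj₁ a'~bd) ∷ []) x~w)
    closed (there (there (there (here refl)))) x~w = around (neighbourhood-⊆ u₃ ≤-refl
      (~-sym G vd ∷ da ∷ ~-sym G cd ∷ ~-sym G (proj₂ a'~bd) ∷ []) x~w)

    cover : ∀ {x} → x ∈ S ⊎ x ∈ X → x ∈ v ∷ a ∷ b ∷ d ∷ c ∷ a' ∷ []
    cover (inj₁ x∈) = ∈-++⁺ˡ x∈
    cover (inj₂ x∈) = ∈-++⁺ʳ S x∈

  -- A triangle around `v` completes to a K₄ with `v`, and a diagonal of a square yields such a
  -- triangle; a square without diagonals is excluded above.
  in-K₄ : ∀ v → ∃ λ L → v ∈ L × K₄ G L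
  in-K₄ v with shortCycle G few (loc v)
  ... | triangle {x} {y} {z} vx vy vz xy yz zx = v ∷ x ∷ y ∷ z ∷ [] , here refl ,
        (vx ∷ vy ∷ vz ∷ []) ∷ (xy ∷ ~-sym G zx ∷ []) ∷ (yz ∷ []) ∷ [] ∷ [] , refl
  ... | square {a} {b} {c} {d} u va vb vc vd ab bc cd da with ~? G a c | ~? G b d
  ... | yes ac | _      = v ∷ a ∷ b ∷ c ∷ [] , here refl ,
        (va ∷ vb ∷ vc ∷ []) ∷ (ab ∷ ac ∷ []) ∷ (bc ∷ []) ∷ [] ∷ [] , refl
  ... | no _   | yes bd = v ∷ b ∷ c ∷ d ∷ [] , here refl ,
        (vb ∷ vc ∷ vd ∷ []) ∷ (bc ∷ bd ∷ []) ∷ (cd ∷ []) ∷ [] ∷ [] , refl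
  ... | no a≁c | no b≁d =
        ⊥-elim (no-induced-square u (va ∷ vb ∷ vc ∷ vd ∷ []) ab bc cd da a≁c b≁d)

  -- If w lies in K' only and x in both, then the neighbourhood of x is K ∪ {w} minus x,
  -- so K' meets K in three vertices, which w and the fourth vertex of K separate.
  K₄-meet⇒⊆ : ∀ {K K' x} → K₄ G K → K₄ G K' → x ∈ K → x ∈ K' → K' ⊆ K
  K₄-meet⇒⊆ {K} {K'} {x} (cK , |K|) (cK' , |K'|) x∈K x∈K' {w} w∈K' with w ∈? K
  ... | yes w∈K = w∈K
  ... | no  w∉K = ⊥-elim (no-separator P X (w ∷ K) short
          (subst (λ k → suc k < n) (≡.sym |K|) (≤-trans (s≤s (s≤s (s≤s (s≤s (s≤s (s≤s z≤n)))))) 8≤n))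
          closed cover {x} (x∈K , x∈K')
          (∉-∷⁺ (λ x≡w → w∉K (subst (_∈ K) x≡w x∈K)) (λ x∈ → proj₂ (∈-∖⁻ K K' x∈) x∈K')))
    where
    P : Fin n → Set
    P y = y ∈ K × y ∈ K'

    X : List (Fin n)
    X = w ∷ K ∖ K'

    -- A common vertex `y` is adjacent to the three other vertices of `K` and, through `K'`, to `w`:
    -- these are all four of its neighbours.
    neighbour : ∀ {y z} → P y → y ~ z → z ∈ w ∷ K
    neighbour {y} {z} (y∈K , y∈K') y~z = shrink
      (neighbourhood-⊆ {L = w ∷ K ∖ [ y ]}
        (unique-∷ (w∉K ∘ proj₁ ∘ ∈-∖⁻ K _) (∖-unique _ (clique⇒unique G cK)))
        (subst (_≤ suc (length (K ∖ [ y ]))) |K| (unique-⊆-length (clique⇒unique G cK) K⊆))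
        (All.tabulate adjacent) y~z)
      where
      K⊆ : K ⊆ y ∷ K ∖ [ y ]
      K⊆ {t} t∈ with t ≟ y
      ... | yes t≡y = here t≡y
      ... | no  t≢y = there (∈-∖⁺ t∈ (∉-∷⁺ t≢y ∉-[]))
      adjacent : ∀ {t} → t ∈ w ∷ K ∖ [ y ] → y ~ t
      adjacent (here refl) = clique-adj G cK' y∈K' w∈K' λ { refl → w∉K y∈K }
      adjacent (there t∈)  =
        let t∈K , t∉y = ∈-∖⁻ K _ t∈ in clique-adj G cK y∈K t∈K (≢-sym (proj₁ (∉-∷⁻ t∉y)))
      shrink : ∀ {t} → t ∈ w ∷ K ∖ [ y ] → t ∈ w ∷ K
      shrink (here e)   = here e
      shrink (there t∈) = there (proj₁ (∈-∖⁻ K _ t∈))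

    closed : ∀ {y z} → P y → y ~ z → P z ⊎ z ∈ X
    closed {y} {z} Py y~z with neighbour Py y~z
    ... | here e    = inj₂ (here e)
    ... | there z∈K with z ∈? K'
    ... | yes z∈K' = inj₁ (z∈K , z∈K')
    ... | no  z∉K' = inj₂ (there (∈-∖⁺ z∈K z∉K'))

    cover : ∀ {y} → P y ⊎ y ∈ X → y ∈ w ∷ K
    cover (inj₁ (y∈K , _))    = there y∈K
    cover (inj₂ (here e))     = here e
    cover (inj₂ (there y∈))   = there (proj₁ (∈-∖⁻ K K' y∈))

    -- Apart from `x`, the vertices of `K'` are neighbours of `x`, so `w` is the only one outside
    -- `K`.
    K'⊆ : K' ⊆ w ∷ K ∩ K'
    K'⊆ {y} y∈K' with y ≟ x
    ... | yes refl = there (∈-∩⁺ x∈K x∈K')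
    ... | no  y≢x with neighbour (x∈K , x∈K') (clique-adj G cK' x∈K' y∈K' (≢-sym y≢x))
    ... | here e    = here e
    ... | there y∈K = there (∈-∩⁺ y∈K y∈K')

    3≤ : 3 ≤ length (K ∩ K')
    3≤ = s≤s⁻¹ (subst (_≤ suc (length (K ∩ K'))) |K'| (unique-⊆-length (clique⇒unique G cK') K'⊆))

    -- At most one vertex of `K` is missing from `K'`, so `X` has at most two vertices.
    short : length X < 4
    short = s≤s (s≤s (m≤n⇒m≤1+n (+-cancelˡ-≤ 3 _ 1 (begin
      3 + length (K ∖ K')                  ≤⟨ +-monoˡ-≤ (length (K ∖ K')) 3≤ ⟩
      length (K ∩ K') + length (K ∖ K')    ≡⟨ length-∩+∖ K K' ⟩
      length K                             ≡⟨ |K| ⟩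
      4                                    ∎))))
      where open ≤-Reasoning

  block : Fin n → List (Fin n)
  block v = proj₁ (in-K₄ v)

  ∈-block : ∀ v → v ∈ block v
  ∈-block v = proj₁ (proj₂ (in-K₄ v))

  block-K₄ : ∀ v → K₄ G (block v)
  block-K₄ v = proj₂ (proj₂ (in-K₄ v))

  -- `L` is a union of blocks, and removing the block of its head takes away exactly four vertices.
  -- The bound `k` only makes the recursion structural.
  4∣length : ∀ k L → length L ≤ k → Unique L → (∀ {v} → v ∈ L → block v ⊆ L) → 4 ∣ length L
  4∣length _       []          _     _ _     = 4 ∣0
  4∣length (suc k) L@(v ∷ L') (s≤s ≤k) u union =
    subst (4 ∣_) (trans (cong (_+ length (L ∖ B)) (≡.sym |L∩B|)) (length-∩+∖ L B))
      (∣m∣n⇒∣m+n ∣-refl (4∣length k (L ∖ B) smaller (∖-unique B u) union'))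
    where
    B : List (Fin n)
    B = block v

    |L∩B| : length (L ∩ B) ≡ 4
    |L∩B| = trans (≤-antisym
      (unique-⊆-length (∩-unique B u) (proj₂ ∘ ∈-∩⁻ L B))
      (unique-⊆-length (clique⇒unique G (proj₁ (block-K₄ v))) (λ x∈ → ∈-∩⁺ (union (here refl) x∈) x∈)))
      (proj₂ (block-K₄ v))

    smaller : length (L ∖ B) ≤ k
    smaller = ≤-trans (s≤s⁻¹ (length-∖ L B (here refl) (∈-block v))) ≤k

    union' : ∀ {y} → y ∈ L ∖ B → block y ⊆ L ∖ B
    union' {y} y∈ z∈ with ∈-∖⁻ L B y∈
    -- If `block y` met `B`, it would be contained in `B`, and so would `y`.
    ... | y∈L , y∉B = ∈-∖⁺ (union y∈L z∈) λ z∈B →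
          y∉B (K₄-meet⇒⊆ (block-K₄ v) (block-K₄ y) z∈B z∈ (∈-block y))

  4∣n : 4 ∣ n
  4∣n = subst (4 ∣_) (length-tabulate id)
    (4∣length n (allFin n) (≤-reflexive (length-tabulate id)) (Unique.allFin⁺ n) (λ _ _ → ∈-allFin _))

lower-bound : ∀ {n} → 8 ≤ n → (G : Graph n) → KConnected 4 G → LocallyNonforesty G → h n ≤ size G
lower-bound {n} 8≤n G conn loc with n % 4 ≟ℕ 0
... | yes _   = 2n≤size G conn
... | no  4∤n = ≤-trans (≤-reflexive (+-comm (2 * n) 1)) (≤∧≢⇒< (2n≤size G conn) λ eq →
  4∤n (n∣m⇒m%n≡0 n 4 (FourRegular.4∣n G 8≤n conn loc (2n≡size⇒regular G conn (≡.sym eq)))))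

-- Attaching a K₄ to a pair of disjoint edges

-- Takes a relation instead of a graph so that it can be applied to `unlinked`, the graph without
-- its two distinguished edges.
K₄At : ∀ {n} → (Fin n → Fin n → Bool) → Fin n → Set
K₄At E v = ∃ λ x → ∃ λ y → ∃ λ z →
  (E v x ≡ true × E v y ≡ true × E v z ≡ true) × (E x y ≡ true × E y z ≡ true × E z x ≡ true)

sum-zero : ∀ {n} {f : Fin n → ℕ} → (∀ i → f i ≡ 0) → sum f ≡ 0
sum-zero {zero}  f≡0 = refl
sum-zero {suc n} f≡0 = cong₂ _+_ (f≡0 zero) (sum-zero (f≡0 ∘ suc))

sum-split : ∀ m {n} (f : Fin (m + n) → ℕ) →
  sum f ≡ sum (λ i → f (i ↑ˡ n)) + sum (λ j → f (m ↑ʳ j))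
sum-split zero    f = refl
sum-split (suc m) f = trans (cong (f zero +_) (sum-split m (f ∘ suc))) (≡.sym (+-assoc (f zero) _ _))

sum-indicator : ∀ {n} (x : Fin n) → sum (λ v → ⟦ does (x ≟ v) ⟧) ≡ 1
sum-indicator {suc n} zero    = cong suc (sum-zero {n} {λ _ → 0} λ _ → refl)
sum-indicator {suc n} (suc x) = sum-indicator x

indicator-split : ∀ {P : Set} b (p? : Dec P) → (P → b ≡ true) →
  ⟦ does p? ⟧ + ⟦ b ∧ not (does p?) ⟧ ≡ ⟦ b ⟧
indicator-split b (yes p) P⇒b rewrite P⇒b p = refl
indicator-split b (no _)  _   = cong ⟦_⟧ (∧-identityʳ b)

-- The two distinguished edges of a LinkedGraph join port i to port (opp i).
opp : Fin 4 → Fin 4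
opp 0F = 2F
opp 1F = 3F
opp 2F = 0F
opp 3F = 1F

opp-involutive : ∀ i → opp (opp i) ≡ i
opp-involutive 0F = refl
opp-involutive 1F = refl
opp-involutive 2F = refl
opp-involutive 3F = refl

opp-≢ : ∀ i → i ≢ opp i
opp-≢ 0F ()
opp-≢ 1F ()
opp-≢ 2F ()
opp-≢ 3F ()

module _ {n : ℕ} (G : Graph n) (port : Fin 4 → Fin n) where

  Link : Fin n → Fin n → Set
  Link u v = ∃ λ i → port i ≡ u × port (opp i) ≡ v

  link? : ∀ u v → Dec (Link u v)
  link? u v = any? λ i → (port i ≟ u) ×-dec (port (opp i) ≟ v)

  unlinked : Fin n → Fin n → Bool
  unlinked u v = adj G u v ∧ not (does (link? u v))

  link-sym : ∀ {u v} → Link u v → Link v u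
  link-sym (i , p , q) = opp i , q , trans (cong port (opp-involutive i)) p

  unlinked-sym : ∀ u v → unlinked u v ≡ unlinked v u
  unlinked-sym u v = cong₂ (λ a b → a ∧ not b) (sym G u v)
    (does-⇔ (mk⇔ link-sym link-sym) (link? u v) (link? v u))

  unlinked⁺ : ∀ {u v} → u ~[ G ] v → ¬ Link u v → unlinked u v ≡ true
  unlinked⁺ {u} {v} u~v ¬link = cong₂ (λ a b → a ∧ not b) u~v (dec-false (link? u v) ¬link)

-- The induction invariant. The K₄s avoid the distinguished edges, so they survive the subdivision;
-- `degrees` says that there are `h n` edges, in the doubled form that is easy to update vertex by
-- vertex.
record LinkedGraph (n : ℕ) : Set where
  field
    G        : Graph n
    port     : Fin 4 → Fin n
    port-inj : ∀ {i j} → port i ≡ port j → i ≡ j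
    port-adj : ∀ i → port i ~[ G ] port (opp i)
    conn     : KConnected 4 G
    K₄-at    : ∀ v → K₄At (unlinked G port) v
    degrees  : sum (deg G) ≡ 2 * h n

h-+4 : ∀ n → h (4 + n) ≡ 8 + h n
-- `(4 + n) % 4` computes to `n % 4`, so one case split decides both sides.
h-+4 n with n % 4 ≟ℕ 0
... | yes _ = *-distribˡ-+ 2 4 n
... | no  _ = cong (_+ 1) (*-distribˡ-+ 2 4 n)

module Attach {n : ℕ} (L : LinkedGraph n) where
  open LinkedGraph L

  old : Fin n → Fin (4 + n)
  old v = 4 ↑ʳ v

  new : Fin 4 → Fin (4 + n)
  new i = i ↑ˡ n

  data View : Fin (4 + n) → Set where
    isNew : ∀ i → View (new i)
    isOld : ∀ v → View (old v)

  view : ∀ x → View x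
  view 0F                          = isNew 0F
  view 1F                          = isNew 1F
  view 2F                          = isNew 2F
  view 3F                          = isNew 3F
  view (suc (suc (suc (suc v)))) = isOld v

  new≢old : ∀ {i v} → new i ≢ old v
  new≢old {0F} ()
  new≢old {1F} ()
  new≢old {2F} ()
  new≢old {3F} ()

  -- Each link becomes the path through `port i`, `new i`, `new (opp i)`, `port (opp i)`; the other
  -- four edges between new vertices complete the K₄.
  adj⁺ : Fin 4 ⊎ Fin n → Fin 4 ⊎ Fin n → Bool
  adj⁺ (inj₁ i) (inj₁ j) = not (does (i ≟ j))
  adj⁺ (inj₁ i) (inj₂ v) = does (port i ≟ v)
  adj⁺ (inj₂ u) (inj₁ j) = does (port j ≟ u)
  adj⁺ (inj₂ u) (inj₂ v) = unlinked G port u v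

  adj⁺-irrefl : ∀ x → adj⁺ x x ≡ false
  adj⁺-irrefl (inj₁ i) = cong not (dec-true (i ≟ i) refl)
  adj⁺-irrefl (inj₂ v) = cong (_∧ _) (irrefl G v)

  adj⁺-sym : ∀ x y → adj⁺ x y ≡ adj⁺ y x
  adj⁺-sym (inj₁ i) (inj₁ j) = cong not (does-⇔ (mk⇔ ≡.sym ≡.sym) (i ≟ j) (j ≟ i))
  adj⁺-sym (inj₁ i) (inj₂ v) = refl
  adj⁺-sym (inj₂ u) (inj₁ j) = refl
  adj⁺-sym (inj₂ u) (inj₂ v) = unlinked-sym G port u v

  G⁺ : Graph (4 + n)
  G⁺ = record
    { adj    = λ x y → adj⁺ (splitAt 4 x) (splitAt 4 y)
    ; irrefl = λ x → adj⁺-irrefl (splitAt 4 x)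
    ; sym    = λ x y → adj⁺-sym (splitAt 4 x) (splitAt 4 y)
    }

  new~new : ∀ {i j} → i ≢ j → new i ~[ G⁺ ] new j
  new~new {i} {j} i≢j rewrite splitAt-↑ˡ 4 i n | splitAt-↑ˡ 4 j n =
    cong not (dec-false (i ≟ j) i≢j)

  port~new : ∀ i → old (port i) ~[ G⁺ ] new i
  port~new i rewrite splitAt-↑ˡ 4 i n = dec-true (port i ≟ port i) refl

  new~port : ∀ i → new i ~[ G⁺ ] old (port i)
  new~port i = ~-sym G⁺ {old (port i)} {new i} (port~new i)

  old~old : ∀ {u v} → u ~[ G ] v → ¬ Link G port u v → old u ~[ G⁺ ] old v
  old~old = unlinked⁺ G port

  -- 4-connectivity of the enlarged graph

  module _ (X : List (Fin (4 + n))) (short : length X < 4) where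

    -- For X in the enlarged graph, deleting W from the original one leaves it connected, and its walks
    -- lift since a deleted new vertex is charged to an end of the link that it subdivides.
    class : Fin 4 → Fin 4
    class 0F = 0F
    class 1F = 1F
    class 2F = 0F
    class 3F = 1F

    class-end : ∀ i → class i ≡ i ⊎ class i ≡ opp i
    class-end 0F = inj₁ refl
    class-end 1F = inj₁ refl
    class-end 2F = inj₂ refl
    class-end 3F = inj₂ refl

    class-opp : ∀ i → class (opp i) ≡ class i
    class-opp 0F = refl
    class-opp 1F = refl
    class-opp 2F = refl
    class-opp 3F = refl

    charge : Fin (4 + n) → Fin n
    charge x = [ port ∘ class , id ]′ (splitAt 4 x)

    charge-new : ∀ i → charge (new i) ≡ port (class i)
    charge-new i = cong [ port ∘ class , id ]′ (splitAt-↑ˡ 4 i n)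

    W : List (Fin n)
    W = map charge X

    W-short : length W < 4
    W-short = subst (_< 4) (≡.sym (length-map charge X)) short

    old∉ : ∀ {u} → u ∉ W → old u ∉ X
    old∉ u∉W = u∉W ∘ ∈-map⁺ charge

    new∉ : ∀ i → port (class i) ∉ W → new i ∉ X
    new∉ i r∉W i∈X = r∉W (subst (_∈ W) (charge-new i) (∈-map⁺ charge i∈X))

    Reach : Fin (4 + n) → Fin (4 + n) → Set
    Reach = WalkAvoiding G⁺ X

    -- Both subdividing vertices are charged to the same end of the link. Neither end is in `W`, so
    -- neither subdividing vertex is in `X`.
    detour : ∀ i → port i ∉ W → port (opp i) ∉ W → Reach (old (port i)) (old (port (opp i)))
    detour i p∉ q∉ =
      step (old∉ p∉) (port~new i)
        (step (new∉ i r∉) (new~new (opp-≢ i))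
          (walk-edge (new∉ (opp i) (subst (λ k → port k ∉ W) (≡.sym (class-opp i)) r∉)) (old∉ q∉)
            (new~port (opp i))))
      where
      r∉ : port (class i) ∉ W
      r∉ with class-end i
      ... | inj₁ e = subst (λ k → port k ∉ W) (≡.sym e) p∉
      ... | inj₂ e = subst (λ k → port k ∉ W) (≡.sym e) q∉

    lift-edge : ∀ {u v} → u ∉ W → v ∉ W → u ~[ G ] v → Reach (old u) (old v)
    lift-edge {u} {v} u∉ v∉ u~v with link? G port u v
    ... | yes (i , refl , refl) = detour i u∉ v∉
    ... | no ¬link              = walk-edge (old∉ u∉) (old∉ v∉) (old~old u~v ¬link)

    lift : ∀ {u v} → WalkAvoiding G W u v → Reach (old u) (old v)
    lift (here u∉)     = here (old∉ u∉)
    lift (step u∉ e p) = walk-trans (lift-edge u∉ (start∉ p) e) (lift p)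

    -- The core is the set of old vertices outside `W`, any two of which are joined through `lift`.
    -- It remains to bring every other surviving vertex there.
    ToCore : Fin (4 + n) → Set
    ToCore x = ∃ λ t → t ∉ W × Reach x (old t)

    -- An old vertex of W outside X is a port; it keeps a neighbour outside W that is not its mate.
    old-to-core : ∀ u → old u ∉ X → ToCore (old u)
    old-to-core u u∉X with u ∈? W
    ... | no u∉W = u , u∉W , here u∉X
    ... | yes u∈W with ∈-map⁻ charge u∈W
    ... | x , x∈X , u≡ with view x
    ... | isOld v = contradiction (subst (λ w → old w ∈ X) (≡.sym u≡) x∈X) u∉X
    ... | isNew i with refl ← trans u≡ (charge-new i) = escape
      where
      k : Fin 4
      k = class i
      -- Exchanging `port k` in `W` for its mate keeps fewer than four vertices, and lets `port k`
      -- itself be a starting point.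
      avoid : List (Fin n)
      avoid = port (opp k) ∷ W ∖ [ port k ]
      escape : ToCore (old (port k))
      escape with neighbour-outside conn (port k) avoid
                    (≤-trans (s≤s (length-∖ W _ u∈W (here refl))) W-short)
                    (∉-∷⁺ (opp-≢ k ∘ port-inj) λ k∈ → proj₂ (∈-∖⁻ W _ k∈) (here refl))
      ... | t , k~t , t∉ = t , t∉W , walk-edge u∉X (old∉ t∉W) (old~old k~t ¬link)
        where
        t∉W : t ∉ W
        t∉W t∈W = proj₂ (∉-∷⁻ t∉) (∈-∖⁺ t∈W (∉-∷⁺ (~⇒≢ G (~-sym G k~t)) ∉-[]))
        ¬link : ¬ Link G port (port k) t
        ¬link (j , p , refl) with refl ← port-inj p = proj₁ (∉-∷⁻ t∉) refl

    Blocked : Fin 4 → Set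
    Blocked j = new j ∈ X ⊎ old (port j) ∈ X

    -- The four pairs of `new j` and `old (port j)` are disjoint, so meeting all of them takes four
    -- vertices of `X`.
    not-all-blocked : ¬ (∀ j → Blocked j)
    not-all-blocked blocked = <⇒≱ short (unique-⊆-length {xs = tabulate hit} (Unique.tabulate⁺ hit-inj) hit∈)
      where
      hit : Fin 4 → Fin (4 + n)
      hit j = [ (λ _ → new j) , (λ _ → old (port j)) ]′ (blocked j)
      hit∈ : tabulate hit ⊆ X
      hit∈ x∈ with ∈-tabulate⁻ {f = hit} x∈
      ... | j , refl with blocked j
      ... | inj₁ p = p
      ... | inj₂ p = p
      hit-inj : ∀ {i j} → hit i ≡ hit j → i ≡ j
      hit-inj {i} {j} e with blocked i | blocked j
      ... | inj₁ _ | inj₁ _ = ↑ˡ-injective n i j e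
      ... | inj₁ _ | inj₂ _ = contradiction e (new≢old {i})
      ... | inj₂ _ | inj₁ _ = contradiction (≡.sym e) (new≢old {j})
      ... | inj₂ _ | inj₂ _ = port-inj (↑ʳ-injective 4 _ _ e)

    -- An unblocked `j` provides the exit: cross the K₄ to `new j`, then go to its port.
    new-to-core : ∀ i → new i ∉ X → ToCore (new i)
    new-to-core i i∉ with ¬∀⟶∃¬ 4 Blocked (λ j → (new j ∈? X) ⊎-dec (old (port j) ∈? X)) not-all-blocked
    ... | j , free with old-to-core (port j) (free ∘ inj₂)
    ... | t , t∉ , p = t , t∉ , walk-trans to-j (step (free ∘ inj₁) (new~port j) p)
      where
      to-j : Reach (new i) (new j)
      to-j with i ≟ j
      ... | yes refl = here i∉
      ... | no  i≢j  = walk-edge i∉ (free ∘ inj₁) (new~new i≢j)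

    to-core : ∀ x → x ∉ X → ToCore x
    to-core x x∉ with view x
    ... | isNew i = new-to-core i x∉
    ... | isOld v = old-to-core v x∉

    connected⁺ : ConnectedAvoiding G⁺ X
    connected⁺ x y x∉ y∉ with to-core x x∉ | to-core y y∉
    ... | s , s∉ , p | t , t∉ , q =
      walk-trans p (walk-trans (lift (proj₂ conn W W-short s t s∉ t∉)) (walk-sym q))

  -- Degrees, new links and K₄s of the enlarged graph

  deg-new : ∀ i → deg G⁺ (new i) ≡ 4
  deg-new 0F = cong (3 +_) (sum-indicator (port 0F))
  deg-new 1F = cong (3 +_) (sum-indicator (port 1F))
  deg-new 2F = cong (3 +_) (sum-indicator (port 2F))
  deg-new 3F = cong (3 +_) (sum-indicator (port 3F))

  -- The links lost at `u` balance the new neighbours gained, which is why old degrees do not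
  -- change. Both sums are 1 at a port, by injectivity, and 0 elsewhere.
  links-at : ∀ u → sum (λ v → ⟦ does (link? G port u v) ⟧) ≡ sum (λ i → ⟦ does (port i ≟ u) ⟧)
  links-at u with any? (λ i → port i ≟ u)
  ... | no ¬port = trans
    (sum-zero λ v → cong ⟦_⟧ (dec-false (link? G port u v) λ (i , p , _) → ¬port (i , p)))
    (≡.sym (sum-zero λ i → cong ⟦_⟧ (dec-false (port i ≟ u) λ p → ¬port (i , p))))
  ... | yes (i , refl) = begin
    sum (λ v → ⟦ does (link? G port (port i) v) ⟧)
      ≡⟨ sum-cong-≗ (λ v → cong ⟦_⟧ (does-⇔ (mk⇔ only (λ q → i , refl , q)) (link? G port (port i) v) (port (opp i) ≟ v))) ⟩
    sum (λ v → ⟦ does (port (opp i) ≟ v) ⟧)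
      ≡⟨ sum-indicator (port (opp i)) ⟩
    1
      ≡⟨ sum-indicator i ⟨
    sum (λ j → ⟦ does (i ≟ j) ⟧)
      ≡⟨ sum-cong-≗ (λ j → cong ⟦_⟧ (does-⇔ (mk⇔ (cong port ∘ ≡.sym) (≡.sym ∘ port-inj)) (i ≟ j) (port j ≟ port i))) ⟩
    sum (λ j → ⟦ does (port j ≟ port i) ⟧) ∎
    where
    open ≡.≡-Reasoning
    only : ∀ {v} → Link G port (port i) v → port (opp i) ≡ v
    only (j , p , q) with refl ← port-inj p = q

  deg-old : ∀ u → deg G⁺ (old u) ≡ deg G u
  deg-old u = begin
    deg G⁺ (old u)
      ≡⟨ sum-split 4 (λ x → ⟦ adj G⁺ (old u) x ⟧) ⟩
    sum (λ i → ⟦ adj G⁺ (old u) (new i) ⟧) + sum (λ v → ⟦ unlinked G port u v ⟧)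
      ≡⟨ cong (_+ sum (λ v → ⟦ unlinked G port u v ⟧)) (trans (sum-cong-≗ λ i → cong (λ s → ⟦ adj⁺ (inj₂ u) s ⟧) (splitAt-↑ˡ 4 i n))
                            (≡.sym (links-at u))) ⟩
    sum (λ v → ⟦ does (link? G port u v) ⟧) + sum (λ v → ⟦ unlinked G port u v ⟧)
      ≡⟨ ∑-distrib-+ (λ v → ⟦ does (link? G port u v) ⟧) _ ⟨
    sum (λ v → ⟦ does (link? G port u v) ⟧ + ⟦ unlinked G port u v ⟧)
      ≡⟨ sum-cong-≗ pointwise ⟩
    deg G u ∎
    where
    open ≡.≡-Reasoning
    pointwise : ∀ v → ⟦ does (link? G port u v) ⟧ + ⟦ unlinked G port u v ⟧ ≡ ⟦ adj G u v ⟧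
    pointwise v = indicator-split (adj G u v) (link? G port u v) λ { (i , refl , refl) → port-adj i }

  degrees⁺ : sum (deg G⁺) ≡ 2 * h (4 + n)
  degrees⁺ = begin
    sum (deg G⁺)                   ≡⟨ sum-split 4 (deg G⁺) ⟩
    sum (λ i → deg G⁺ (new i)) + sum (λ v → deg G⁺ (old v))
                                   ≡⟨ cong₂ _+_ (sum-cong-≗ deg-new) (sum-cong-≗ deg-old) ⟩
    16 + sum (deg G)               ≡⟨ cong (16 +_) degrees ⟩
    16 + 2 * h n                   ≡⟨ *-distribˡ-+ 2 8 (h n) ⟨
    2 * (8 + h n)                  ≡⟨ cong (2 *_) (h-+4 n) ⟨
    2 * h (4 + n)                  ∎
    where open ≡.≡-Reasoning

  -- The next links are two end edges of the subdivided paths. Each joins an old vertex to a new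
  -- one, so it lies neither in the new K₄ nor in a K₄ of old vertices.
  port⁺ : Fin 4 → Fin (4 + n)
  port⁺ 0F = old (port 0F)
  port⁺ 1F = old (port 1F)
  port⁺ 2F = new 0F
  port⁺ 3F = new 1F

  port⁺-inj : ∀ {i j} → port⁺ i ≡ port⁺ j → i ≡ j
  port⁺-inj {0F} {0F} _ = refl
  port⁺-inj {0F} {1F} e with () ← port-inj (↑ʳ-injective 4 _ _ e)
  port⁺-inj {0F} {2F} ()
  port⁺-inj {0F} {3F} ()
  port⁺-inj {1F} {2F} ()
  port⁺-inj {1F} {3F} ()
  port⁺-inj {2F} {3F} ()
  port⁺-inj {1F} {0F} e with () ← port-inj (↑ʳ-injective 4 _ _ e)
  port⁺-inj {1F} {1F} _ = refl
  port⁺-inj {2F} {2F} _ = refl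
  port⁺-inj {3F} {3F} _ = refl

  port⁺-adj : ∀ i → port⁺ i ~[ G⁺ ] port⁺ (opp i)
  port⁺-adj 0F = port~new 0F
  port⁺-adj 1F = port~new 1F
  port⁺-adj 2F = new~port 0F
  port⁺-adj 3F = new~port 1F

  ¬link-old : ∀ {u v} → ¬ Link G⁺ port⁺ (old u) (old v)
  ¬link-old (0F , _ , ())
  ¬link-old (1F , _ , ())
  ¬link-old (2F , () , _)
  ¬link-old (3F , () , _)

  ¬link-new : ∀ {i j} → ¬ Link G⁺ port⁺ (new i) (new j)
  ¬link-new {i} {j} (0F , p , _) = new≢old {i} (≡.sym p)
  ¬link-new {i} {j} (1F , p , _) = new≢old {i} (≡.sym p)
  ¬link-new {i} {j} (2F , _ , q) = new≢old {j} (≡.sym q)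
  ¬link-new {i} {j} (3F , _ , q) = new≢old {j} (≡.sym q)

  old-unlinked : ∀ {u v} → unlinked G port u v ≡ true → unlinked G⁺ port⁺ (old u) (old v) ≡ true
  old-unlinked {u} {v} e = unlinked⁺ G⁺ port⁺ {old u} {old v} e (¬link-old {u} {v})

  new-unlinked : ∀ i j → i ≢ j → unlinked G⁺ port⁺ (new i) (new j) ≡ true
  new-unlinked i j i≢j = unlinked⁺ G⁺ port⁺ (new~new i≢j) (¬link-new {i} {j})

  K₄-new : ∀ i → K₄At (unlinked G⁺ port⁺) (new i)
  K₄-new 0F = new 1F , new 2F , new 3F ,
    (new-unlinked 0F 1F (λ ()) , new-unlinked 0F 2F (λ ()) , new-unlinked 0F 3F (λ ())) ,
    (new-unlinked 1F 2F (λ ()) , new-unlinked 2F 3F (λ ()) , new-unlinked 3F 1F (λ ()))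
  K₄-new 1F = new 0F , new 2F , new 3F ,
    (new-unlinked 1F 0F (λ ()) , new-unlinked 1F 2F (λ ()) , new-unlinked 1F 3F (λ ())) ,
    (new-unlinked 0F 2F (λ ()) , new-unlinked 2F 3F (λ ()) , new-unlinked 3F 0F (λ ()))
  K₄-new 2F = new 0F , new 1F , new 3F ,
    (new-unlinked 2F 0F (λ ()) , new-unlinked 2F 1F (λ ()) , new-unlinked 2F 3F (λ ())) ,
    (new-unlinked 0F 1F (λ ()) , new-unlinked 1F 3F (λ ()) , new-unlinked 3F 0F (λ ()))
  K₄-new 3F = new 0F , new 1F , new 2F ,
    (new-unlinked 3F 0F (λ ()) , new-unlinked 3F 1F (λ ()) , new-unlinked 3F 2F (λ ())) ,
    (new-unlinked 0F 1F (λ ()) , new-unlinked 1F 2F (λ ()) , new-unlinked 2F 0F (λ ()))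

  K₄-at⁺ : ∀ x → K₄At (unlinked G⁺ port⁺) x
  K₄-at⁺ x with view x
  ... | isNew i = K₄-new i
  ... | isOld v =
    let a , b , c , (va , vb , vc) , (ab , bc , ca) = K₄-at v
    in old a , old b , old c ,
       (old-unlinked va , old-unlinked vb , old-unlinked vc) ,
       (old-unlinked ab , old-unlinked bc , old-unlinked ca)

attach : ∀ {n} → LinkedGraph n → LinkedGraph (4 + n)
attach L = record
  { G        = G⁺
  ; port     = port⁺
  ; port-inj = port⁺-inj
  ; port-adj = port⁺-adj
  ; conn     = ≤-trans (proj₁ (LinkedGraph.conn L)) (m≤n+m _ 4) , connected⁺
  ; K₄-at    = K₄-at⁺
  ; degrees  = degrees⁺
  }
  where open Attach L

-- Base cases

module _ {n : ℕ} (G : Graph n) where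

  Touched : List (Fin n) → Fin n → Set
  Touched C v = Any (λ c → c ~[ G ] v) C

  touched? : ∀ C v → Dec (Touched C v)
  touched? C v = Any.any? (λ c → adj G c v ≟ᵇ true) C

  -- Breadth-first search from the layer C through the vertices R not yet visited.
  exhausts : ℕ → List (Fin n) → List (Fin n) → Bool
  exhausts _       C []         = true
  -- Exhausted fuel answers `false`, so soundness is not affected by the choice of fuel.
  exhausts zero    C (_ ∷ _)    = false
  exhausts (suc k) C R@(_ ∷ _) =
    exhausts k (filter (touched? C) R) (filter (λ v → ¬? (touched? C v)) R)

  reach-touched : ∀ {X r C w} → (∀ {c} → c ∈ C → WalkAvoiding G X r c) →
    w ∉ X → Touched C w → WalkAvoiding G X r w
  reach-touched reached w∉X t with c , c∈C , c~w ← find t =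
    let p = reached c∈C in walk-trans p (walk-edge (start∉ (walk-sym p)) w∉X c~w)

  exhausts-sound : ∀ {X r} k C R → exhausts k C R ≡ true → (∀ {v} → v ∈ R → v ∉ X) →
    (∀ {c} → c ∈ C → WalkAvoiding G X r c) → ∀ {v} → v ∈ R → WalkAvoiding G X r v
  exhausts-sound (suc k) C R@(_ ∷ _) ok R∉X reached {v} v∈R with touched? C v
  ... | yes t = reach-touched reached (R∉X v∈R) t
  ... | no ¬t = exhausts-sound k _ _ ok
    (R∉X ∘ proj₁ ∘ ∈-filter⁻ (λ v → ¬? (touched? C v)) {xs = R})
    (λ c∈ → let c∈R , t = ∈-filter⁻ (touched? C) {xs = R} c∈ in reach-touched reached (R∉X c∈R) t)
    (∈-filter⁺ (λ v → ¬? (touched? C v)) v∈R ¬t)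

  spans : List (Fin n) → Bool
  spans [] = true
  spans (r ∷ R) = exhausts n [ r ] R

  spans-sound : ∀ X → spans (allFin n ∖ X) ≡ true → ConnectedAvoiding G X
  spans-sound X ok u v u∉ v∉ = join (survivor u∉) (survivor v∉) ok (λ x∈ → proj₂ (∈-∖⁻ (allFin n) X x∈))
    where
    survivor : ∀ {x} → x ∉ X → x ∈ allFin n ∖ X
    survivor = ∈-∖⁺ (∈-allFin _)
    join : ∀ {L} → u ∈ L → v ∈ L → spans L ≡ true → (∀ {x} → x ∈ L → x ∉ X) → WalkAvoiding G X u v
    join {r ∷ R} u∈ v∈ ok L∉X = walk-trans (walk-sym (from-r u∈)) (from-r v∈)
      where
      from-r : ∀ {x} → x ∈ r ∷ R → WalkAvoiding G X r x
      from-r (here refl) = here (L∉X (here refl))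
      from-r (there x∈)  = exhausts-sound n [ r ] R ok (L∉X ∘ there) (λ { (here refl) → here (L∉X (here refl)) }) x∈

-- Recursion on the first entry reduces the quantifier over lists to finitely many tests; for `k`
-- equal to 4 it tests all lists of length at most 3, repetitions included.
short-lists? : ∀ {n} {P : List (Fin n) → Set} → (∀ X → Dec (P X)) → ∀ k → Dec (∀ X → length X < k → P X)
short-lists? P? zero    = yes λ _ ()
short-lists? P? (suc k) = map′
  (λ { (P[] , _) [] _ → P[] ; (_ , P∷) (x ∷ X) (s≤s <k) → P∷ x X <k })
  (λ P → P [] (s≤s z≤n) , λ x X <k → P (x ∷ X) (s≤s <k))
  (P? [] ×-dec all? λ x → short-lists? (λ X → P? (x ∷ X)) k)

-- Single edges are cliques on two vertices, and cliques may overlap. Symmetry and irreflexivity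
-- hold by construction, so neither has to be checked per graph.
unionOfCliques : ∀ n → List (List ℕ) → Graph n
unionOfCliques n cliques = record
  { adj    = λ u v → not (does (u ≟ v)) ∧ any (both u v) cliques
  ; irrefl = λ v → cong (λ b → not b ∧ any (both v v) cliques) (dec-true (v ≟ v) refl)
  ; sym    = λ u v → cong₂ (λ b c → not b ∧ or c)
      (does-⇔ (mk⇔ ≡.sym ≡.sym) (u ≟ v) (v ≟ u))
      (map-cong (λ C → ∧-comm (covers u C) (covers v C)) cliques)
  }
  where
  covers : Fin n → List ℕ → Bool
  covers u = any (toℕ u ≡ᵇ_)
  both : Fin n → Fin n → List ℕ → Bool
  both u v C = covers u C ∧ covers v C

module _ {n : ℕ} (G : Graph n) (port : Fin 4 → Fin n) where

  4-connected? : Dec (∀ X → length X < 4 → spans G (allFin n ∖ X) ≡ true)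
  4-connected? = short-lists? (λ X → spans G (allFin n ∖ X) ≟ᵇ true) 4

  port-inj? : Dec (∀ i j → port i ≡ port j → i ≡ j)
  port-inj? = all? λ i → all? λ j → (port i ≟ port j) →-dec (i ≟ j)

  port-adj? : Dec (∀ i → port i ~[ G ] port (opp i))
  port-adj? = all? λ i → adj G (port i) (port (opp i)) ≟ᵇ true

  K₄-at? : Dec (∀ v → K₄At (unlinked G port) v)
  K₄-at? = all? λ v → any? λ x → any? λ y → any? λ z →
    (E? v x ×-dec E? v y ×-dec E? v z) ×-dec (E? x y ×-dec E? y z ×-dec E? z x)
    where
    E? : ∀ u v → Dec (unlinked G port u v ≡ true)
    E? u v = unlinked G port u v ≟ᵇ true

  -- Each `True` argument reduces to the unit type when its decision succeeds, so type checking
  -- carries out the finite verification.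
  linkedGraph : 4 < n → True 4-connected? → True port-inj? → True port-adj? → True K₄-at? →
    sum (deg G) ≡ 2 * h n → LinkedGraph n
  linkedGraph 4<n c i a k d = record
    { G        = G
    ; port     = port
    ; port-inj = toWitness i _ _
    ; port-adj = toWitness a
    ; conn     = 4<n , λ X short → spans-sound G X (toWitness c X short)
    ; K₄-at    = toWitness k
    ; degrees  = d
    }

-- Rings of two K₄s with consecutive blocks joined by two disjoint edges, after contracting
-- 2, 1 or 0 edges of the pair that is not used as ports; linked₉ has K₅ minus an edge as a block.
linked₆ : LinkedGraph 6
linked₆ = linkedGraph
  (unionOfCliques 6 ((0 ∷ 1 ∷ 2 ∷ 3 ∷ []) ∷ (2 ∷ 3 ∷ 4 ∷ 5 ∷ []) ∷ (0 ∷ 4 ∷ []) ∷ (1 ∷ 5 ∷ []) ∷ []))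
  (lookup (# 0 ∷ # 1 ∷ # 4 ∷ # 5 ∷ [])) (toWitness {a? = 5 ≤? 6} _) _ _ _ _ refl

linked₇ : LinkedGraph 7
linked₇ = linkedGraph
  (unionOfCliques 7 ((0 ∷ 1 ∷ 2 ∷ 3 ∷ []) ∷ (3 ∷ 4 ∷ 5 ∷ 6 ∷ []) ∷
    (2 ∷ 4 ∷ []) ∷ (0 ∷ 5 ∷ []) ∷ (1 ∷ 6 ∷ []) ∷ []))
  (lookup (# 0 ∷ # 1 ∷ # 5 ∷ # 6 ∷ [])) (toWitness {a? = 5 ≤? 7} _) _ _ _ _ refl

linked₈ : LinkedGraph 8
linked₈ = linkedGraph
  (unionOfCliques 8 ((0 ∷ 1 ∷ 2 ∷ 3 ∷ []) ∷ (4 ∷ 5 ∷ 6 ∷ 7 ∷ []) ∷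
    (0 ∷ 4 ∷ []) ∷ (1 ∷ 5 ∷ []) ∷ (2 ∷ 6 ∷ []) ∷ (3 ∷ 7 ∷ []) ∷ []))
  (lookup (# 0 ∷ # 1 ∷ # 4 ∷ # 5 ∷ [])) (toWitness {a? = 5 ≤? 8} _) _ _ _ _ refl

linked₉ : LinkedGraph 9
linked₉ = linkedGraph
  (unionOfCliques 9 ((0 ∷ 1 ∷ 2 ∷ 3 ∷ []) ∷ (1 ∷ 2 ∷ 3 ∷ 4 ∷ []) ∷ (5 ∷ 6 ∷ 7 ∷ 8 ∷ []) ∷
    (0 ∷ 5 ∷ []) ∷ (1 ∷ 6 ∷ []) ∷ (3 ∷ 7 ∷ []) ∷ (4 ∷ 8 ∷ []) ∷ []))
  (lookup (# 0 ∷ # 1 ∷ # 5 ∷ # 6 ∷ [])) (toWitness {a? = 5 ≤? 9} _) _ _ _ _ refl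

-- The orders 6 to 9 represent all residues modulo 4, and each attachment raises the order by 4.
linked : ∀ k → LinkedGraph (6 + k)
linked 0 = linked₆
linked 1 = linked₇
linked 2 = linked₈
linked 3 = linked₉
linked (suc (suc (suc (suc k)))) = attach (linked k)

-- Existence of extremal graphs and the final statement

extremal : ∀ {n} → LinkedGraph n →
  Σ (Graph n) (λ G → KConnected 4 G × LocallyNonforesty G × size G ≡ h n)
extremal {n} L = G , conn , wheels , *-cancelˡ-≡ _ _ 2 (begin
    2 * size G        ≡⟨ cong (size G +_) (+-identityʳ _) ⟩
    size G + size G   ≡⟨ handshake G ⟨
    sum (deg G)       ≡⟨ degrees ⟩
    2 * h n           ∎)
  where
  open LinkedGraph L
  open ≡.≡-Reasoning
  edge : ∀ {u v} → unlinked G port u v ≡ true → u ~[ G ] v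
  edge = ∧-conicalˡ _ _
  wheels : LocallyNonforesty G
  wheels v with x , y , z , (vx , vy , vz) , (xy , yz , zx) ← K₄-at v = record
    { x        = x
    ; xs       = y ∷ z ∷ []
    ; long     = ≤-refl
    ; distinct = (~⇒≢ G (edge xy) ∷ ≢-sym (~⇒≢ G (edge zx)) ∷ []) ∷ (~⇒≢ G (edge yz) ∷ []) ∷ [] ∷ []
    ; inside   = edge vx ∷ edge vy ∷ edge vz ∷ []
    ; closed   = edge xy ∷ edge yz ∷ edge zx ∷ [-]
    }

theorem2 : ∀ (n : ℕ) → 8 ≤ n →
    ((G : Graph n) → KConnected 4 G → LocallyNonforesty G → h n ≤ size G)
    × Σ (Graph n) (λ G → KConnected 4 G × LocallyNonforesty G × size G ≡ h n)
theorem2 n 8≤n = lower-bound 8≤n , subst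
  (λ m → Σ (Graph m) (λ G → KConnected 4 G × LocallyNonforesty G × size G ≡ h m))
  (m+[n∸m]≡n (≤-trans (m≤n+m 6 2) 8≤n)) (extremal (linked (n ∸ 6)))
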